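{- For each integer $d\ge 1$, the power series expansion at $x=0$ of the rational function $$\Delta_d(x)=\frac{1}{(1-x)^{d+1}-x^{d+1}}-\frac{1}{1-2x}$$ has only nonnegative coefficients. -}

module Defs where

open import Algebra.Properties.Semiring.Sum using (sum; sum-cong-≗)
open import Data.Fin.Base using (Fin; zero; suc; toℕ)
open import Data.Integer.Base using (ℤ; +_; 0ℤ; 1ℤ; _+_; _-_; _*_)
open import Data.Integer.Properties using (+-*-commutativeSemiring; *-identityˡ; +-identityʳ)
open import Data.Integer.Solver using (module +-*-Solver)
open import Data.Nat.Base using (ℕ; zero; suc; _∸_)
open import Data.Vec.Base using (Vec; []; _∷_; head; lookup)
open import Algebra.Bundles using (CommutativeSemiring)
open import Relation.Binary.PropositionalEquality

∑ : (n : ℕ) → (Fin n → ℤ) → ℤ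
∑ n = sum (CommutativeSemiring.semiring +-*-commutativeSemiring) {n}

-- Formal power series over ℤ: f n is the coefficient of xⁿ. All denominators
-- below have constant term 1, so their reciprocals already exist over ℤ.
Series : Set
Series = ℕ → ℤ

const : ℤ → Series
const c zero    = c
const c (suc n) = 0ℤ

X : Series
X (suc zero) = 1ℤ
X _          = 0ℤ

infixl 6 _-ˢ_
infixl 7 _*ˢ_
infixr 8 _^ˢ_

_-ˢ_ : Series → Series → Series
(f -ˢ g) n = f n - g n

_*ˢ_ : Series → Series → Series
(f *ˢ g) n = ∑ (suc n) λ k → f (toℕ k) * g (n ∸ toℕ k)

_^ˢ_ : Series → ℕ → Series
f ^ˢ zero  = const 1ℤ
f ^ˢ suc m = f *ˢ (f ^ˢ m)

-- If f has constant term 1, the coefficients of g = 1/f are determined by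
--   g n = [n = 0] - Σ_{k < n} f (k + 1) * g (n - 1 - k).
-- The vector recipCoeffs f n holds g (n - 1) , … , g 0 in this order.
recipCoeffs : Series → (n : ℕ) → Vec ℤ n
recipCoeffs f zero    = []
recipCoeffs f (suc n) =
  (const 1ℤ n - ∑ n λ k → f (suc (toℕ k)) * lookup (recipCoeffs f n) k)
    ∷ recipCoeffs f n

recip : (f : Series) → .(f 0 ≡ 1ℤ) → Series
recip f _ n = head (recipCoeffs f (suc n))

private
  ∑-cong : ∀ n {s t : Fin n → ℤ} → s ≗ t → ∑ n s ≡ ∑ n t
  ∑-cong n = sum-cong-≗ (CommutativeSemiring.semiring +-*-commutativeSemiring) {n}

  open +-*-Solver

  cancel : ∀ a b → 1ℤ * (a - b) + b ≡ a
  cancel = solve 2 (λ a b → con 1ℤ :* (a :- b) :+ b := a) refl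

  isolate : ∀ a b → a ≡ (1ℤ * a + b) - b
  isolate = solve 2 (λ a b → a := (con 1ℤ :* a :+ b) :- b) refl

  lookup-recip : ∀ f .(p : f 0 ≡ 1ℤ) n (k : Fin n) →
                 lookup (recipCoeffs f n) k ≡ recip f p (n ∸ suc (toℕ k))
  lookup-recip f p (suc n) zero    = refl
  lookup-recip f p (suc n) (suc k) = lookup-recip f p n k

recip-inverse : ∀ f (p : f 0 ≡ 1ℤ) → f *ˢ recip f p ≗ const 1ℤ
recip-inverse f p n = begin
  f 0 * recip f p n + ∑ n (λ k → f (suc (toℕ k)) * recip f p (n ∸ suc (toℕ k)))
    ≡⟨ cong₂ (λ a b → a * recip f p n + b) p
         (∑-cong n λ k → cong (f (suc (toℕ k)) *_) (sym (lookup-recip f p n k))) ⟩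
  1ℤ * recip f p n + tail
    ≡⟨ cancel (const 1ℤ n) tail ⟩
  const 1ℤ n ∎
  where
  open ≡-Reasoning
  tail = ∑ n λ k → f (suc (toℕ k)) * lookup (recipCoeffs f n) k

recip-unique : ∀ f (p : f 0 ≡ 1ℤ) g → f *ˢ g ≗ const 1ℤ → g ≗ recip f p
recip-unique f p g fg≗1 n = sym (lookup-g (suc n) zero)
  where
  open ≡-Reasoning

  lookup-g : ∀ m (k : Fin m) → lookup (recipCoeffs f m) k ≡ g (m ∸ suc (toℕ k))
  lookup-g (suc m) (suc k) = lookup-g m k
  lookup-g (suc m) zero    = begin
    const 1ℤ m - ∑ m (λ k → f (suc (toℕ k)) * lookup (recipCoeffs f m) k)
      ≡⟨ cong₂ _-_ (sym (fg≗1 m)) (∑-cong m λ k → cong (f (suc (toℕ k)) *_) (lookup-g m k)) ⟩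
    (f 0 * g m + rest) - rest
      ≡⟨ cong (λ a → (a * g m + rest) - rest) p ⟩
    (1ℤ * g m + rest) - rest
      ≡⟨ sym (isolate (g m) rest) ⟩
    g m ∎
    where rest = ∑ m λ k → f (suc (toℕ k)) * g (m ∸ suc (toℕ k))

denom : ℕ → Series
denom d = (const 1ℤ -ˢ X) ^ˢ suc d -ˢ X ^ˢ suc d

1-2X : Series
1-2X = const 1ℤ -ˢ const (+ 2) *ˢ X

denom-constant : ∀ d → denom d 0 ≡ 1ℤ
denom-constant d = trans (+-identityʳ _) (one-pow (suc d))
  where
  one-pow : ∀ m → ((const 1ℤ -ˢ X) ^ˢ m) 0 ≡ 1ℤ
  one-pow zero    = refl
  one-pow (suc m) = trans (+-identityʳ _) (trans (*-identityˡ _) (one-pow m))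

Δ : ℕ → Series
Δ d = recip (denom d) (denom-constant d) -ˢ recip 1-2X refl

{-# OPTIONS --safe #-}

-- Let W n i be the number of subsets of an n-set whose size is ≡ i mod d+1.
-- Pascal's rule shows that 1/((1-x)^{d+1} - x^{d+1}) has coefficients
-- W (d+n) d. Every subset of an n-set extends, by at most d further elements,
-- to one of size ≡ d mod d+1; hence W (d+n) d ≥ 2ⁿ, the coefficient of
-- 1/(1-2x).
module Submission where

open import Defs
open import Data.Nat.Base using (ℕ) renaming (_≤_ to _≤ⁿ_)
open import Data.Integer.Base using (0ℤ; _≤_)

open import Algebra.Bundles using (CommutativeSemiring)
open import Algebra.Properties.Semiring.Sum using (sum-cong-≗; *-distribˡ-sum)
open import Data.Fin.Base using (Fin; zero; suc; toℕ)
open import Data.Integer.Base using (ℤ; +_; 1ℤ; _+_; _-_; _*_; +≤+)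
import Data.Integer.Properties as ℤ
open import Data.Integer.Solver using (module +-*-Solver)
open import Data.Nat.Base as ℕ using (zero; suc; _∸_; _<_; s<s)
import Data.Nat.Properties as ℕ
open import Data.Nat.Solver renaming (module +-*-Solver to N)
open import Function.Base using (_∘_)
open import Relation.Binary.PropositionalEquality
open import Relation.Nullary.Decidable.Core using (yes; no)

open +-*-Solver
open CommutativeSemiring ℤ.+-*-commutativeSemiring using (semiring)

∑-cong : ∀ n {s t : Fin n → ℤ} → s ≗ t → ∑ n s ≡ ∑ n t
∑-cong n = sum-cong-≗ semiring {n}

∑-zero : ∀ n {s : Fin n → ℤ} → (∀ k → s k ≡ 0ℤ) → ∑ n s ≡ 0ℤ
∑-zero zero    s≗0 = refl
∑-zero (suc n) s≗0 = cong₂ _+_ (s≗0 zero) (∑-zero n (s≗0 ∘ suc))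

∑-distrib-- : ∀ n (s t : Fin n → ℤ) → ∑ n (λ k → s k - t k) ≡ ∑ n s - ∑ n t
∑-distrib-- zero    s t = refl
∑-distrib-- (suc n) s t = trans
  (cong (_+_ (s zero - t zero)) (∑-distrib-- n (s ∘ suc) (t ∘ suc)))
  (solve 4 (λ a b c e → (a :- b) :+ (c :- e) := (a :+ c) :- (b :+ e)) refl
    (s zero) (t zero) (∑ n (s ∘ suc)) (∑ n (t ∘ suc)))

pos-+-cancelˡ : ∀ a b → + (a ℕ.+ b) - + a ≡ + b
pos-+-cancelˡ a b = trans (cong (_- + a) (ℤ.pos-+ a b))
  (solve 2 (λ x y → (x :+ y) :- x := y) refl (+ a) (+ b))

-- Multiplication by X and by 1 - X as operators on series

shift : Series → Series
shift f zero    = 0ℤ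
shift f (suc n) = f n

shift-cong : ∀ {f g} → f ≗ g → shift f ≗ shift g
shift-cong f≗g zero    = refl
shift-cong f≗g (suc n) = f≗g n

δ : Series → Series
δ f = f -ˢ shift f

δ-cong : ∀ {f g} → f ≗ g → δ f ≗ δ g
δ-cong f≗g n = cong₂ _-_ (f≗g n) (shift-cong f≗g n)

*ˢ-congʳ : ∀ {f g} → f ≗ g → ∀ h → f *ˢ h ≗ g *ˢ h
*ˢ-congʳ f≗g h n = ∑-cong (suc n) λ k → cong (_* h (n ∸ toℕ k)) (f≗g (toℕ k))

*ˢ-distribʳ--ˢ : ∀ f g h → (f -ˢ g) *ˢ h ≗ f *ˢ h -ˢ g *ˢ h
*ˢ-distribʳ--ˢ f g h n = trans
  (∑-cong (suc n) λ k →
    solve 3 (λ a b c → (a :- b) :* c := a :* c :- b :* c) refl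
      (f (toℕ k)) (g (toℕ k)) (h (n ∸ toℕ k)))
  (∑-distrib-- (suc n) (λ k → f (toℕ k) * h (n ∸ toℕ k)) (λ k → g (toℕ k) * h (n ∸ toℕ k)))

const-*ˢ : ∀ c f n → (const c *ˢ f) n ≡ c * f n
const-*ˢ c f n = trans
  (cong (_+_ (c * f n)) (∑-zero n λ k → ℤ.*-zeroˡ (f (n ∸ suc (toℕ k)))))
  (ℤ.+-identityʳ _)

1-*ˢ : ∀ f → const 1ℤ *ˢ f ≗ f
1-*ˢ f n = trans (const-*ˢ 1ℤ f n) (ℤ.*-identityˡ (f n))

shift-*ˢ : ∀ f g → shift f *ˢ g ≗ shift (f *ˢ g)
shift-*ˢ f g zero    = refl
shift-*ˢ f g (suc n) = trans
  (cong (_+ (f *ˢ g) n) (ℤ.*-zeroˡ (g (suc n)))) (ℤ.+-identityˡ _)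

X-*ˢ : ∀ f → X *ˢ f ≗ shift f
X-*ˢ f n = begin
  (X *ˢ f) n                  ≡⟨ *ˢ-congʳ X≗shift1 f n ⟩
  (shift (const 1ℤ) *ˢ f) n   ≡⟨ shift-*ˢ (const 1ℤ) f n ⟩
  shift (const 1ℤ *ˢ f) n     ≡⟨ shift-cong (1-*ˢ f) n ⟩
  shift f n                   ∎
  where
  open ≡-Reasoning
  X≗shift1 : X ≗ shift (const 1ℤ)
  X≗shift1 zero          = refl
  X≗shift1 (suc zero)    = refl
  X≗shift1 (suc (suc n)) = refl

1-X-*ˢ : ∀ f → (const 1ℤ -ˢ X) *ˢ f ≗ δ f
1-X-*ˢ f n = trans (*ˢ-distribʳ--ˢ (const 1ℤ) X f n)
                   (cong₂ _-_ (1-*ˢ f n) (X-*ˢ f n))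

X^-suc-*ˢ : ∀ m f → X ^ˢ suc m *ˢ f ≗ shift (X ^ˢ m *ˢ f)
X^-suc-*ˢ m f n = trans (*ˢ-congʳ (X-*ˢ (X ^ˢ m)) f n) (shift-*ˢ (X ^ˢ m) f n)

-- Since `shift` commutes with multiplication by `f`, so does `δ`. One factor `1 - X` is thus peeled
-- off a power without general associativity of `*ˢ`.
1-X^-suc-*ˢ : ∀ m f → (const 1ℤ -ˢ X) ^ˢ suc m *ˢ f ≗ δ ((const 1ℤ -ˢ X) ^ˢ m *ˢ f)
1-X^-suc-*ˢ m f n = begin
  (((const 1ℤ -ˢ X) *ˢ P) *ˢ f) n        ≡⟨ *ˢ-congʳ (1-X-*ˢ P) f n ⟩
  (δ P *ˢ f) n                           ≡⟨ *ˢ-distribʳ--ˢ P (shift P) f n ⟩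
  (P *ˢ f) n - (shift P *ˢ f) n          ≡⟨ cong (_-_ ((P *ˢ f) n)) (shift-*ˢ P f n) ⟩
  δ (P *ˢ f) n                           ∎
  where
  open ≡-Reasoning
  P = (const 1ℤ -ˢ X) ^ˢ m

X^-*ˢ-< : ∀ m f {n} → n < m → (X ^ˢ m *ˢ f) n ≡ 0ℤ
X^-*ˢ-< (suc m) f {zero}  _         = X^-suc-*ˢ m f zero
X^-*ˢ-< (suc m) f {suc n} (s<s n<m) = trans (X^-suc-*ˢ m f (suc n)) (X^-*ˢ-< m f n<m)

X^-*ˢ-+ : ∀ m f n → (X ^ˢ m *ˢ f) (m ℕ.+ n) ≡ f n
X^-*ˢ-+ zero    f n = 1-*ˢ f n
X^-*ˢ-+ (suc m) f n = trans (X^-suc-*ˢ m f (suc m ℕ.+ n)) (X^-*ˢ-+ m f n)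

-- The geometric series of 1/(1 - 2x)

recip-1-2X : ∀ n → + (2 ℕ.^ n) ≡ recip 1-2X refl n
recip-1-2X = recip-unique 1-2X refl pow eq
  where
  open ≡-Reasoning
  pow : Series
  pow n = + (2 ℕ.^ n)

  2X*pow : (const (+ 2) *ˢ X) *ˢ pow ≗ λ n → + 2 * shift pow n
  2X*pow n = begin
    ((const (+ 2) *ˢ X) *ˢ pow) n       ≡⟨ *ˢ-congʳ (const-*ˢ (+ 2) X) pow n ⟩
    ((λ k → + 2 * X k) *ˢ pow) n
      ≡⟨ ∑-cong (suc n) (λ k → ℤ.*-assoc (+ 2) (X (toℕ k)) (pow (n ∸ toℕ k))) ⟩
    ∑ (suc n) (λ k → + 2 * (X (toℕ k) * pow (n ∸ toℕ k)))
      ≡⟨ *-distribˡ-sum semiring {suc n} (+ 2) (λ k → X (toℕ k) * pow (n ∸ toℕ k)) ⟨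
    + 2 * (X *ˢ pow) n                  ≡⟨ cong (+ 2 *_) (X-*ˢ pow n) ⟩
    + 2 * shift pow n                   ∎

  telescope : ∀ n → pow n - + 2 * shift pow n ≡ const 1ℤ n
  telescope zero    = refl
  telescope (suc n) = ℤ.i≡j⇒i-j≡0 (ℤ.pos-* 2 (2 ℕ.^ n))

  eq : 1-2X *ˢ pow ≗ const 1ℤ
  eq n = begin
    (1-2X *ˢ pow) n
      ≡⟨ *ˢ-distribʳ--ˢ (const 1ℤ) (const (+ 2) *ˢ X) pow n ⟩
    (const 1ℤ *ˢ pow) n - ((const (+ 2) *ˢ X) *ˢ pow) n
      ≡⟨ cong₂ _-_ (1-*ˢ pow n) (2X*pow n) ⟩
    pow n - + 2 * shift pow n           ≡⟨ telescope n ⟩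
    const 1ℤ n                          ∎

-- Subsets counted by size modulo d + 1

module _ (d : ℕ) where

  -- Meaningful for i ≤ d only; for i > d it is a harmless extension.
  W : ℕ → ℕ → ℕ
  W zero    zero    = 1
  W zero    (suc i) = 0
  W (suc n) zero    = W n zero ℕ.+ W n d
  W (suc n) (suc i) = W n (suc i) ℕ.+ W n i

  -- From `n < i` the recursion only reaches pairs of the same kind, so it ends at `W zero (suc _)`
  -- and never meets the wrap-around at index `zero`.
  W-< : ∀ {n i} → n < i → W n i ≡ 0
  W-< {zero}  {suc i} _         = refl
  W-< {suc n} {suc i} (s<s n<i) = cong₂ ℕ._+_ (W-< (ℕ.m<n⇒m<1+n n<i)) (W-< n<i)

  W-diag : ∀ i → W i i ≡ 1
  W-diag zero    = refl
  W-diag (suc i) = cong₂ ℕ._+_ (W-< (ℕ.n<1+n i)) (W-diag i)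

  W-mono : ∀ k n i → W n i ≤ⁿ W (k ℕ.+ n) i
  W-mono zero    n i       = ℕ.≤-refl
  W-mono (suc k) n zero    = ℕ.≤-trans (W-mono k n zero) (ℕ.m≤m+n _ _)
  W-mono (suc k) n (suc i) = ℕ.≤-trans (W-mono k n (suc i)) (ℕ.m≤m+n _ _)

  S : ℕ → ℕ → ℕ
  S n zero    = W n zero
  S n (suc i) = W n (suc i) ℕ.+ S n i

  -- Pascal's rule splits `W (suc i + n) (suc i)` into `W (i + n) (suc i)` and `W (i + n) i`:
  -- monotonicity bounds the first from below, induction the second.
  S≤W : ∀ i n → S n i ≤ⁿ W (i ℕ.+ n) i
  S≤W zero    n = ℕ.≤-refl
  S≤W (suc i) n = ℕ.+-mono-≤ (W-mono i n (suc i)) (S≤W i n)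

  -- Summing Pascal's rule over the indices 0 to `i` counts each `W n j` with `j < i` twice, `W n i`
  -- once, and the wrapped term `W n d` once. Adding `W n i` on the left avoids subtraction.
  S-suc : ∀ n i → S (suc n) i ℕ.+ W n i ≡ 2 ℕ.* S n i ℕ.+ W n d
  S-suc n zero    = N.solve 2 (λ a b → (a N.:+ b) N.:+ a N.:= N.con 2 N.:* a N.:+ b) refl
                      (W n zero) (W n d)
  S-suc n (suc i) = begin
    ((b ℕ.+ a) ℕ.+ S (suc n) i) ℕ.+ b
      ≡⟨ N.solve 3 (λ a b s → ((b N.:+ a) N.:+ s) N.:+ b N.:= N.con 2 N.:* b N.:+ (s N.:+ a)) refl
           a b (S (suc n) i) ⟩
    2 ℕ.* b ℕ.+ (S (suc n) i ℕ.+ a)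
      ≡⟨ cong (2 ℕ.* b ℕ.+_) (S-suc n i) ⟩
    2 ℕ.* b ℕ.+ (2 ℕ.* S n i ℕ.+ W n d)
      ≡⟨ N.solve 3 (λ b s w → N.con 2 N.:* b N.:+ (N.con 2 N.:* s N.:+ w)
                         N.:= N.con 2 N.:* (b N.:+ s) N.:+ w) refl b (S n i) (W n d) ⟩
    2 ℕ.* (b ℕ.+ S n i) ℕ.+ W n d ∎
    where
    open ≡-Reasoning
    a = W n i
    b = W n (suc i)

  S-zero : ∀ i → S zero i ≡ 1
  S-zero zero    = refl
  S-zero (suc i) = S-zero i

  S-total : ∀ n → S n d ≡ 2 ℕ.^ n
  S-total zero    = S-zero d
  -- At `i = d` the two extra terms of `S-suc` coincide; cancelling them leaves a plain doubling.
  S-total (suc n) = trans (ℕ.+-cancelʳ-≡ (W n d) _ _ (S-suc n d))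
                          (cong (2 ℕ.*_) (S-total n))

  -- Column `i` of `W` without its `i` leading zeros. `G d` will turn out to be the reciprocal of
  -- `denom d`.
  G : ℕ → Series
  G i n = + W (i ℕ.+ n) i

  2^≤G : ∀ n → + (2 ℕ.^ n) ≤ G d n
  2^≤G n = +≤+ (subst (_≤ⁿ W (d ℕ.+ n) d) (S-total n) (S≤W d n))

  -- Pascal's rule read as a difference along column `suc i`. At coefficient 0 nothing is
  -- subtracted, and both sides are diagonal entries, equal to 1.
  δG-suc : ∀ i → δ (G (suc i)) ≗ G i
  δG-suc i zero    = begin
    + W (suc i ℕ.+ 0) (suc i) - 0ℤ   ≡⟨ ℤ.+-identityʳ _ ⟩
    + W (suc i ℕ.+ 0) (suc i)        ≡⟨ cong (λ k → + W k (suc i)) (ℕ.+-identityʳ (suc i)) ⟩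
    + W (suc i) (suc i)              ≡⟨ cong +_ (trans (W-diag (suc i)) (sym (W-diag i))) ⟩
    + W i i                          ≡⟨ cong (λ k → + W k i) (ℕ.+-identityʳ i) ⟨
    + W (i ℕ.+ 0) i                  ∎
    where open ≡-Reasoning
  δG-suc i (suc n) = begin
    + W (suc (i ℕ.+ suc n)) (suc i) - + W (suc (i ℕ.+ n)) (suc i)
      ≡⟨ cong (λ k → + W (suc (i ℕ.+ suc n)) (suc i) - + W k (suc i)) (ℕ.+-suc i n) ⟨
    + W (suc (i ℕ.+ suc n)) (suc i) - + W (i ℕ.+ suc n) (suc i)
      ≡⟨ pos-+-cancelˡ (W (i ℕ.+ suc n) (suc i)) (W (i ℕ.+ suc n) i) ⟩
    + W (i ℕ.+ suc n) i ∎
    where open ≡-Reasoning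

  -- Multiplying by `X ^ˢ d` restores the zeros dropped in `G d`; below `d` they agree with `W n d`
  -- by `W-<`.
  X^d*G : X ^ˢ d *ˢ G d ≗ λ n → + W n d
  X^d*G n with n ℕ.<? d
  ... | yes n<d = trans (X^-*ˢ-< d (G d) n<d) (cong +_ (sym (W-< n<d)))
  ... | no  n≮d = subst (λ k → (X ^ˢ d *ˢ G d) k ≡ + W k d)
                    (ℕ.m+[n∸m]≡n (ℕ.≮⇒≥ n≮d)) (X^-*ˢ-+ d (G d) (n ∸ d))

  -- Each factor `1 - X` lowers the column by one. `j` stays free because the inductive step uses
  -- the hypothesis at `suc j`.
  1-X^-*G : ∀ i j → (const 1ℤ -ˢ X) ^ˢ i *ˢ G (i ℕ.+ j) ≗ G j
  1-X^-*G zero    j n = 1-*ˢ (G j) n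
  1-X^-*G (suc i) j n = begin
    ((const 1ℤ -ˢ X) ^ˢ suc i *ˢ G (suc i ℕ.+ j)) n
      ≡⟨ 1-X^-suc-*ˢ i (G (suc i ℕ.+ j)) n ⟩
    δ ((const 1ℤ -ˢ X) ^ˢ i *ˢ G (suc i ℕ.+ j)) n
      ≡⟨ cong (λ k → δ ((const 1ℤ -ˢ X) ^ˢ i *ˢ G k) n) (ℕ.+-suc i j) ⟨
    δ ((const 1ℤ -ˢ X) ^ˢ i *ˢ G (i ℕ.+ suc j)) n
      ≡⟨ δ-cong (1-X^-*G i (suc j)) n ⟩
    δ (G (suc j)) n
      ≡⟨ δG-suc j n ⟩
    G j n ∎
    where open ≡-Reasoning

  1-X^d*G : (const 1ℤ -ˢ X) ^ˢ d *ˢ G d ≗ G 0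
  1-X^d*G = subst (λ k → (const 1ℤ -ˢ X) ^ˢ d *ˢ G k ≗ G 0)
              (ℕ.+-identityʳ d) (1-X^-*G d 0)

  -- This is where the wrap-around clause of `W` enters: it cancels every positive coefficient, and
  -- `W zero zero = 1` gives the constant term.
  δG-zero : ∀ n → δ (G 0) n - shift (λ k → + W k d) n ≡ const 1ℤ n
  δG-zero zero    = refl
  δG-zero (suc n) = ℤ.i≡j⇒i-j≡0 (pos-+-cancelˡ (W n 0) (W n d))

  denom-*G : denom d *ˢ G d ≗ const 1ℤ
  denom-*G n = begin
    (denom d *ˢ G d) n
      ≡⟨ *ˢ-distribʳ--ˢ ((const 1ℤ -ˢ X) ^ˢ suc d) (X ^ˢ suc d) (G d) n ⟩
    ((const 1ℤ -ˢ X) ^ˢ suc d *ˢ G d) n - (X ^ˢ suc d *ˢ G d) n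
      ≡⟨ cong₂ _-_ (1-X^-suc-*ˢ d (G d) n) (X^-suc-*ˢ d (G d) n) ⟩
    δ ((const 1ℤ -ˢ X) ^ˢ d *ˢ G d) n - shift (X ^ˢ d *ˢ G d) n
      ≡⟨ cong₂ _-_ (δ-cong 1-X^d*G n) (shift-cong X^d*G n) ⟩
    δ (G 0) n - shift (λ k → + W k d) n
      ≡⟨ δG-zero n ⟩
    const 1ℤ n ∎
    where open ≡-Reasoning

theorem3p3 : (d : ℕ) → 1 ≤ⁿ d → (n : ℕ) → 0ℤ ≤ Δ d n
theorem3p3 d _ n = ℤ.i≤j⇒0≤j-i
  -- Uniqueness of reciprocals turns the bound `2^≤G` into one between the two series in `Δ d`.
  (subst₂ _≤_ (recip-1-2X n)
    (recip-unique (denom d) (denom-constant d) (G d d) (denom-*G d) n) (2^≤G d n))
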